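{- Let $p$ be an odd prime. Then \[ \sum_{k=0}^{p-1}\frac{92k^2+61k+9}{(2k+1)64^k}\binom{2k}{k}\binom{3k}{k}\binom{4k}{2k}\equiv 9p \pmod{p^3}. \]
   Context: Congruences between rational numbers whose denominators are prime to $p$ are understood in the ring of $p$-integral rationals: $a\equiv b \pmod{p^m}$ means $(a-b)/p^m$ is a rational number with denominator prime to $p$. -}

module Defs where

open import Data.Nat as ℕ using (ℕ; zero; suc; _^_; NonZero)
open import Data.Nat.Divisibility using (_∣_)
open import Data.Nat.Properties using (m*n≢0; m^n≢0)
open import Data.Nat.Combinatorics using (_C_)
open import Data.Integer as ℤ using (ℤ; +_)
open import Data.Rational as ℚ using (ℚ; 0ℚ; _/_; _+_; _-_; _*_)
open import Data.Product using (Σ; ∃; _×_)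
open import Relation.Nullary using (¬_)
open import Relation.Binary.PropositionalEquality using (_≡_)

sumTo : ℕ → (ℕ → ℚ) → ℚ
sumTo zero    f = 0ℚ
sumTo (suc n) f = sumTo n f + f n

den : ℕ → ℕ
den k = suc (2 ℕ.* k) ℕ.* (64 ^ k)

den≢0 : ∀ k → NonZero (den k)
den≢0 k = m*n≢0 (suc (2 ℕ.* k)) (64 ^ k) {{_}} {{m^n≢0 64 k}}

term : ℕ → ℚ
term k = ((+ (92 ℕ.* k ℕ.* k ℕ.+ 61 ℕ.* k ℕ.+ 9)) / den k) {{den≢0 k}}
         * (+ (((2 ℕ.* k) C k) ℕ.* ((3 ℕ.* k) C k) ℕ.* ((4 ℕ.* k) C (2 ℕ.* k))) / 1)

-- a ≡ b (mod p^m) in the ring of p-integral rationals: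
-- (a - b) / p^m = u / v with u ∈ ℤ, v ∈ ℕ, v ≠ 0, p ∤ v.
CongModPow : ℕ → ℕ → ℚ → ℚ → Set
CongModPow p m a b =
  Σ ℤ λ u → Σ ℕ λ v → Σ (NonZero v) λ v≢0 →
    (¬ (p ∣ v)) × (a - b ≡ ((+ (p ^ m)) / 1) * (u / v) {{v≢0}})

{-# OPTIONS --safe #-}
module Submission where

-- Write c(i) = C(2i,i), let (b)ᵢ be the rising factorial, and put
-- R(b,n) = Σ_{i<n} 4^(n-1-i) c(i) (b)ᵢ/i!. Gauss's evaluation of ₂F₁(1/2,b;1;1) has a truncated
-- form, a contiguity relation between R(b,n) and R(b+1,n), valid for every integer b. Used at
-- b = 2n and b = 2n+1 it shows that the first n terms of the series add up to
-- 96 n C(4n,2n) R(2n,n) / 64^n. Used at b = -1, …, -p it gives 2 R(-p,p) = C(2p,p).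
-- Modulo p² one has (2p)ᵢ/i! ≡ -2 (-p)ᵢ/i! for 0 < i < p, hence
-- R(2p,p) ≡ 3e - 2 R(-p,p) = 3e - C(2p,p), with e = 4^(p-1). As C(2p,p) ≡ 2, C(4p,2p) ≡ 6 and
-- e ≡ 1 (mod p), the numerator 96 p C(4p,2p) R(2p,p) is 576 p (3e-2) ≡ 576 p e³ = 9p · 64^p (mod p³).

open import Defs
open import Data.Nat using (ℕ; _*_; _∸_)
open import Data.Nat.Primality using (Prime)
open import Data.Integer using (+_)
open import Data.Rational using (_/_)
open import Relation.Nullary using (¬_)
open import Relation.Binary.PropositionalEquality using (_≡_)

open import Data.Nat as ℕ using (zero; suc; z≤n; s≤s; NonZero)
import Data.Nat.Properties as ℕ
import Data.Nat.Divisibility as ℕ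
open import Data.Nat.Combinatorics
  using (_C_; nC1≡n; nCn≡1; nCk≡nC[n∸k]; k>n⇒nCk≡0; nCk+nC[k+1]≡[n+1]C[k+1])
open import Data.Nat.Primality
  using (euclidsLemma; prime[2]; prime⇒irreducible; prime⇒nonZero; ¬prime[0]; ¬prime[1])
open import Data.Integer
  using (ℤ; -_; _+_; _-_; _^_; ∣_∣; 0ℤ; 1ℤ) renaming (_*_ to _·_; NonZero to IntegerNonZero)
import Data.Integer.Properties as ℤ
open import Data.Integer.Divisibility.Signed
  using (_∣_; divides; ∣ᵤ⇒∣; ∣⇒∣ᵤ; 0∣⇒≡0; ∣-trans;
         ∣m∣n⇒∣m+n; ∣m∣n⇒∣m-n; ∣n⇒∣m*n; ∣m⇒∣m*n; *-cancelʳ-∣; *-monoʳ-∣; *-monoˡ-∣)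
open import Data.Integer.Tactic.RingSolver using (solve-∀)
open import Data.Empty using (⊥-elim)
open import Data.Product using (_×_; _,_; proj₁)
open import Data.Sum using (_⊎_; inj₁; inj₂)
open import Function using (_∘_)
open import Relation.Binary.PropositionalEquality
  using (refl; sym; trans; cong; cong₂; subst; module ≡-Reasoning)
open import Data.Nat.Properties using (m^n≢0)
open import Data.Rational as ℚ using (toℚᵘ)
import Data.Rational.Properties as ℚ
open import Data.Rational.Unnormalised as ℚᵘ using (mkℚᵘ; *≡*; _≃_)
import Data.Rational.Unnormalised.Properties as ℚᵘ

-- Lets an equation x ≡ y be used inside a ring identity, as a multiple of x - y.
modulo : ∀ {l r x y} a → x ≡ y → l ≡ r + a · (x - y) → l ≡ r
modulo {r = r} {x} a refl e = trans e (ring r a x)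
  where
  ring : ∀ r a x → r + a · (x - x) ≡ r
  ring = solve-∀

-- Binomial coefficients in ℤ

abstract

  -- Abstract, so that binomial coefficients stay atoms for the ring solver and are never evaluated;
  -- `bin-def` recovers `_C_` outside the block.
  bin : ℕ → ℕ → ℤ
  bin n k = + (n C k)

  bin-def : ∀ n k → bin n k ≡ + (n C k)
  bin-def n k = refl

  pascal : ∀ n k → bin (suc n) (suc k) ≡ bin n k + bin n (suc k)
  pascal n k = cong +_ (sym (nCk+nC[k+1]≡[n+1]C[k+1] n k))

  bin-zero : ∀ n → bin n 0 ≡ 1ℤ
  bin-zero n = cong +_ (trans (nCk≡nC[n∸k] {0} {n} z≤n) (nCn≡1 n))

  bin-one : ∀ n → bin n 1 ≡ + n
  bin-one n = cong +_ (nC1≡n n)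

  bin-self : ∀ n → bin n n ≡ 1ℤ
  bin-self n = cong +_ (nCn≡1 n)

  bin-small : ∀ {n k} → n ℕ.< k → bin n k ≡ 0ℤ
  bin-small n<k = cong +_ (k>n⇒nCk≡0 n<k)

  bin-sym : ∀ j k → bin (j ℕ.+ k) j ≡ bin (j ℕ.+ k) k
  bin-sym j k = cong +_ (trans (nCk≡nC[n∸k] (ℕ.m≤m+n j k)) (cong ((j ℕ.+ k) C_) (ℕ.m+n∸m≡n j k)))

bin-absorb : ∀ n k → + suc k · bin (suc n) (suc k) ≡ + suc n · bin n k
bin-absorb n zero = begin
  1ℤ · bin (suc n) 1   ≡⟨ ℤ.*-identityˡ _ ⟩
  bin (suc n) 1        ≡⟨ bin-one (suc n) ⟩
  + suc n              ≡⟨ ℤ.*-identityʳ _ ⟨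
  + suc n · 1ℤ         ≡⟨ cong (+ suc n ·_) (bin-zero n) ⟨
  + suc n · bin n 0    ∎
  where open ≡-Reasoning
bin-absorb zero (suc k)
  rewrite bin-small {1} {suc (suc k)} (s≤s (s≤s z≤n)) | bin-small {0} {suc k} (s≤s z≤n) =
  ℤ.*-zeroʳ (+ suc (suc k))
bin-absorb (suc n) (suc k) =
  -- Pascal splits the left side, the induction hypothesis absorbs at k and at k+1, and Pascal in
  -- row n reassembles the two results.
  modulo (+ suc (suc k)) (pascal (suc n) (suc k))
  (modulo 1ℤ (bin-absorb n k)
  (modulo 1ℤ (bin-absorb n (suc k))
  (modulo (- + suc n) (pascal n k)
  (ring (+ n) (+ k) (bin (suc (suc n)) (suc (suc k))) (bin (suc n) (suc k))
    (bin (suc n) (suc (suc k))) (bin n k) (bin n (suc k))))))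
  where
  ring : ∀ n k a b c d e → (+ 2 + k) · a ≡
    (+ 2 + n) · b + (+ 2 + k) · (a - (b + c))
      + 1ℤ · ((1ℤ + k) · b - (1ℤ + n) · d)
      + 1ℤ · ((+ 2 + k) · c - (1ℤ + n) · e)
      + - (1ℤ + n) · (b - (d + e))
  ring = solve-∀

bin-step : ∀ n k → + suc k · bin n (suc k) ≡ (+ n - + k) · bin n k
bin-step n k =
  modulo (- + suc k) (pascal n k) (modulo 1ℤ (bin-absorb n k)
    (ring (+ n) (+ k) (bin (suc n) (suc k)) (bin n k) (bin n (suc k))))
  where
  ring : ∀ n k a b c → (1ℤ + k) · c ≡
    (n - k) · b + - (1ℤ + k) · (a - (b + c)) + 1ℤ · ((1ℤ + k) · a - (1ℤ + n) · b)
  ring = solve-∀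

-- Central binomial coefficients and the contiguity relation

central : ℕ → ℤ
central n = bin (2 * n) n

-- Row 2n+1 has two equal middle entries, so Pascal gives C(2n+2,n+1) = 2 C(2n+1,n+1); absorption
-- does the rest.
central-suc : ∀ n → + suc n · central (suc n) ≡ + 2 · (+ 2 · + n + 1ℤ) · central n
central-suc n = subst (λ m → + suc n · bin m (suc n) ≡ + 2 · (+ 2 · + n + 1ℤ) · central n)
  (sym (ℕ.*-suc 2 n))
  (modulo (+ suc n) (pascal (suc (2 * n)) n)
  (modulo (+ suc n) middle
  (modulo (+ 2) (bin-absorb (2 * n) n)
  (modulo (+ 2 · central n) (ℤ.pos-* 2 n)
    (ring (+ n) (+ (2 * n)) (bin (suc (suc (2 * n))) (suc n)) (bin (suc (2 * n)) n)
      (bin (suc (2 * n)) (suc n)) (central n))))))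
  where
  middle : bin (suc (2 * n)) n ≡ bin (suc (2 * n)) (suc n)
  middle = subst (λ m → bin m n ≡ bin m (suc n))
    (trans (ℕ.+-suc n n) (cong (λ k → suc (n ℕ.+ k)) (sym (ℕ.+-identityʳ n))))
    (bin-sym n (suc n))
  ring : ∀ n m x y z c → (1ℤ + n) · x ≡
    + 2 · (+ 2 · n + 1ℤ) · c + (1ℤ + n) · (x - (y + z)) + (1ℤ + n) · (y - z)
      + + 2 · ((1ℤ + n) · z - (1ℤ + m) · c) + + 2 · c · (m - + 2 · n)
  ring = solve-∀

-- This is Σ_{i<n} 4^(n-1-i) c(i) h(i). Since c(i)/4^i = (1/2)ᵢ/i!, for h(i) = (b)ᵢ/i! and n > 0 it
-- is 4^(n-1) times the truncated series ₂F₁(1/2,b;1;1). The powers of 4 keep it integral.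
centralSum : (ℕ → ℤ) → ℕ → ℤ
centralSum h zero    = 0ℤ
centralSum h (suc n) = + 4 · centralSum h n + central n · h n

-- The hypotheses say that h i = (b)ᵢ / i! and h′ i = (b+1)ᵢ / i!, for an integer b of either sign.
contiguity : ∀ b h h′ → h 0 ≡ 1ℤ → h′ 0 ≡ 1ℤ →
  (∀ i → h′ (suc i) ≡ h′ i + h (suc i)) →
  (∀ i → + suc i · h′ (suc i) ≡ (1ℤ + b + + i) · h′ i) →
  ∀ n → (+ 2 · b + 1ℤ) · centralSum h′ (suc n)
        ≡ + 2 · b · centralSum h (suc n) + (+ 2 · + n + 1ℤ) · central n · h′ n
contiguity b h h′ h0 h′0 pas abs zero rewrite h0 | h′0 | bin-self 0 = ring b
  where
  ring : ∀ b → (+ 2 · b + 1ℤ) · (+ 4 · 0ℤ + 1ℤ · 1ℤ)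
    ≡ + 2 · b · (+ 4 · 0ℤ + 1ℤ · 1ℤ) + (+ 2 · 0ℤ + 1ℤ) · 1ℤ · 1ℤ
  ring = solve-∀
contiguity b h h′ h0 h′0 pas abs (suc n) =
  modulo (+ 4) (contiguity b h h′ h0 h′0 pas abs n)
  (modulo (- (+ 2 · h′ n)) (central-suc n)
  (modulo (+ 2 · b · central (suc n)) (pas n)
  (modulo (- (+ 2 · central (suc n))) (abs n)
    (ring b (+ n) (central n) (central (suc n)) (centralSum h (suc n)) (centralSum h′ (suc n))
      (h′ n) (h (suc n)) (h′ (suc n))))))
  where
  ring : ∀ b n c d s s′ x y z →
    (+ 2 · b + 1ℤ) · (+ 4 · s′ + d · z) ≡
    + 2 · b · (+ 4 · s + d · y) + (+ 2 · (1ℤ + n) + 1ℤ) · d · z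
      + + 4 · ((+ 2 · b + 1ℤ) · s′ - (+ 2 · b · s + (+ 2 · n + 1ℤ) · c · x))
      + - (+ 2 · x) · ((1ℤ + n) · d - + 2 · (+ 2 · n + 1ℤ) · c)
      + + 2 · b · d · (z - (x + y))
      + - (+ 2 · d) · ((1ℤ + n) · z - (1ℤ + b + n) · x)
  ring = solve-∀


-- Rising factorials with positive parameter

-- multichoose b i = (b+1)ᵢ / i!
multichoose : ℕ → ℕ → ℤ
multichoose b i = bin (b ℕ.+ i) i

multichoose-pascal : ∀ b i →
  multichoose (suc b) (suc i) ≡ multichoose (suc b) i + multichoose b (suc i)
multichoose-pascal b i =
  trans (pascal (b ℕ.+ suc i) i) (cong (λ k → bin k i + multichoose b (suc i)) (ℕ.+-suc b i))

multichoose-absorb : ∀ b i → + suc i · multichoose b (suc i) ≡ + suc (b ℕ.+ i) · multichoose b i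
multichoose-absorb b i rewrite ℕ.+-suc b i = bin-absorb (b ℕ.+ i) i

-- Both sides are (b+1)ᵢ₊₁/i!.
multichoose-shift : ∀ b i → + suc b · multichoose (suc b) i ≡ + suc (b ℕ.+ i) · multichoose b i
multichoose-shift b zero rewrite bin-zero (suc b ℕ.+ 0) | bin-zero (b ℕ.+ 0) | ℕ.+-identityʳ b = refl
multichoose-shift b (suc i) = subst
  (λ k → + suc b · multichoose (suc b) (suc i) ≡ + suc k · multichoose b (suc i))
  (sym (ℕ.+-suc b i))
  (modulo (+ 2 + + b + + i) (multichoose-pascal b i)
  (modulo (- 1ℤ) (multichoose-absorb (suc b) i)
    (ring (+ b) (+ i) (multichoose (suc b) i) (multichoose b (suc i)) (multichoose (suc b) (suc i)))))
  where
  ring : ∀ b i x y z → (1ℤ + b) · z ≡ (1ℤ + (1ℤ + (b + i))) · y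
      + (+ 2 + b + i) · (z - (x + y)) + - 1ℤ · ((1ℤ + i) · z - (1ℤ + ((1ℤ + b) + i)) · x)
  ring = solve-∀

-- The separate `β` allows the parameter to be given as 2n or 2n+1 in terms of `+ n`, a form open to
-- the ring solver.
multichoose-contiguity : ∀ b {β} → + suc b ≡ β → ∀ n →
  (+ 2 · β + 1ℤ) · centralSum (multichoose (suc b)) (suc n)
  ≡ + 2 · β · centralSum (multichoose b) (suc n)
    + (+ 2 · + n + 1ℤ) · central n · multichoose (suc b) n
multichoose-contiguity b refl = contiguity (+ suc b) (multichoose b) (multichoose (suc b))
  (bin-zero (b ℕ.+ 0)) (bin-zero (suc b ℕ.+ 0)) (multichoose-pascal b) (multichoose-absorb (suc b))

-- Closed form of the partial sums

-- With n = m+1 this is 96 n C(4n,2n) R(2n,n), the numerator over 64^n of the sum of the first n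
-- terms. Indexing by m lets the argument 2n-1 of `multichoose` be written without subtraction.
partialNum : ℕ → ℤ
partialNum m = + 96 · + suc m · central (2 * suc m) · centralSum (multichoose (suc (2 * m))) (suc m)

weight : ℤ → ℤ
weight n = + 92 · n · n + + 61 · n + + 9

central-suc² : ∀ m → (1ℤ + + m) · (+ 2 + + m) · central (suc (suc m))
  ≡ + 4 · (+ 2 · + m + 1ℤ) · (+ 2 · + m + + 3) · central m
central-suc² m =
  modulo (1ℤ + + m) (central-suc (suc m))
  (modulo (+ 2 · (+ 2 · + m + + 3)) (central-suc m)
    (ring (+ m) (central m) (central (suc m)) (central (suc (suc m)))))
  where
  ring : ∀ m c d e → (1ℤ + m) · (+ 2 + m) · e ≡ + 4 · (+ 2 · m + 1ℤ) · (+ 2 · m + + 3) · c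
    + (1ℤ + m) · ((+ 2 + m) · e - + 2 · (+ 2 · (1ℤ + m) + 1ℤ) · d)
    + + 2 · (+ 2 · m + + 3) · ((1ℤ + m) · d - + 2 · (+ 2 · m + 1ℤ) · c)
  ring = solve-∀

-- This is `central-suc²` at 2n, divided by 2.
central-double-suc : ∀ n → (+ 2 · + n + 1ℤ) · (1ℤ + + n) · central (2 * suc n)
  ≡ + 2 · (+ 4 · + n + 1ℤ) · (+ 4 · + n + + 3) · central (2 * n)
central-double-suc n = subst
  (λ k → (+ 2 · + n + 1ℤ) · (1ℤ + + n) · central k
         ≡ + 2 · (+ 4 · + n + 1ℤ) · (+ 4 · + n + + 3) · central (2 * n))
  (sym (ℕ.*-suc 2 n))
  (ℤ.*-cancelˡ-≡ (+ 2) _ _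
    (modulo 1ℤ
      (subst (λ m → (1ℤ + m) · (+ 2 + m) · central (suc (suc (2 * n)))
                    ≡ + 4 · (+ 2 · m + 1ℤ) · (+ 2 · m + + 3) · central (2 * n))
        (ℤ.pos-* 2 n) (central-suc² (2 * n)))
      (ring (+ n) (central (2 * n)) (central (suc (suc (2 * n)))))))
  where
  ring : ∀ n c e → + 2 · ((+ 2 · n + 1ℤ) · (1ℤ + n) · e)
    ≡ + 2 · (+ 2 · (+ 4 · n + 1ℤ) · (+ 4 · n + + 3) · c)
      + 1ℤ · ((1ℤ + + 2 · n) · (+ 2 + + 2 · n) · e
              - + 4 · (+ 2 · (+ 2 · n) + 1ℤ) · (+ 2 · (+ 2 · n) + + 3) · c)
  ring = solve-∀

-- The telescoping step, with the denominator 2n+1 cleared. Contiguity at 2n+1 and then at 2n takes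
-- R(2n+2,n+1) back to R(2n,n); the boundary terms left over, all expressed by `h₁`, add up to 64
-- times the weight 92n²+61n+9.
partialNum-step : ∀ m → let n = suc m in
  (+ 2 · + n + 1ℤ) · partialNum n
  ≡ + 64 · ((+ 2 · + n + 1ℤ) · partialNum m
            + weight (+ n) · (central n · multichoose (2 * n) n · central (2 * n)))
partialNum-step m = subst
  (λ k → (+ 2 · + n + 1ℤ)
         · (+ 96 · + suc n · central (2 * suc n) · centralSum (multichoose (suc k)) (suc n))
         ≡ + 64 · ((+ 2 · + n + 1ℤ) · partialNum m
                   + weight (+ n) · (central n · multichoose k n · central (2 * n))))
  (sym 2n)
  (modulo (+ 96 · s₂) (central-double-suc n)
  (modulo (+ 192 · (+ 4 · + n + 1ℤ) · cc) (multichoose-contiguity (suc b) even+1 n)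
  (modulo (+ 192 · cc · (+ 4 · + n + + 2)) (multichoose-contiguity b even n)
  -- Here the shift reads 2n `h₁` = 3n `h₀` and eliminates `h₀`; the next one reads (2n+1) `h₂` =
  -- (3n+1) `h₁` and eliminates `h₂`.
  (modulo (- (+ 256 · cc · c · (+ 4 · + n + + 2)))
    (subst (λ x → x · h₁ ≡ (x + + n) · h₀) even (multichoose-shift b n))
  (modulo (+ 192 · cc · c · (+ 4 · + n + 1ℤ))
    (subst (λ x → x · h₂ ≡ (x + + n) · h₁) even+1 (multichoose-shift (suc b) n))
    (ring (+ n) c cc (central (2 * suc n)) s₀ s₁ s₂ h₀ h₁ h₂))))))
  where
  n b : ℕ
  n = suc m
  b = suc (2 * m)
  2n : 2 * n ≡ suc b
  2n = ℕ.*-suc 2 m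
  even : + suc b ≡ + 2 · + n
  even = trans (cong +_ (sym 2n)) (ℤ.pos-* 2 n)
  even+1 : + suc (suc b) ≡ 1ℤ + + 2 · + n
  even+1 = cong (λ x → 1ℤ + x) even
  c cc s₀ s₁ s₂ h₀ h₁ h₂ : ℤ
  c = central n
  cc = central (2 * n)
  -- One term shorter than `s₁` and `s₂`, since this is the sum in `partialNum m`; contiguity sees 4
  -- `s₀` + `c` `h₀`.
  s₀ = centralSum (multichoose b) n
  s₁ = centralSum (multichoose (suc b)) (suc n)
  s₂ = centralSum (multichoose (suc (suc b))) (suc n)
  h₀ = multichoose b n
  h₁ = multichoose (suc b) n
  h₂ = multichoose (suc (suc b)) n
  ring : ∀ n c cc cc′ s₀ s₁ s₂ h₀ h₁ h₂ →
    (+ 2 · n + 1ℤ) · (+ 96 · (1ℤ + n) · cc′ · s₂)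
    ≡ + 64 · ((+ 2 · n + 1ℤ) · (+ 96 · n · cc · s₀)
        + (+ 92 · n · n + + 61 · n + + 9) · (c · h₁ · cc))
      + + 96 · s₂ · ((+ 2 · n + 1ℤ) · (1ℤ + n) · cc′
          - + 2 · (+ 4 · n + 1ℤ) · (+ 4 · n + + 3) · cc)
      + + 192 · (+ 4 · n + 1ℤ) · cc · ((+ 2 · (1ℤ + + 2 · n) + 1ℤ) · s₂
          - (+ 2 · (1ℤ + + 2 · n) · s₁ + (+ 2 · n + 1ℤ) · c · h₂))
      + + 192 · cc · (+ 4 · n + + 2) · ((+ 2 · (+ 2 · n) + 1ℤ) · s₁
          - (+ 2 · (+ 2 · n) · (+ 4 · s₀ + c · h₀) + (+ 2 · n + 1ℤ) · c · h₁))
      + - (+ 256 · cc · c · (+ 4 · n + + 2)) · (+ 2 · n · h₁ - (+ 2 · n + n) · h₀)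
      + + 192 · cc · c · (+ 4 · n + 1ℤ) · ((1ℤ + + 2 · n) · h₂ - (1ℤ + + 2 · n + n) · h₁)
  ring = solve-∀

-- Convolution and Vandermonde's identity

-- The Cauchy product Σ_{i+j=k} f(i) g(j); shifting `f` avoids the subtraction k-i.
conv : (ℕ → ℤ) → (ℕ → ℤ) → ℕ → ℤ
conv f g zero    = f 0 · g 0
conv f g (suc k) = f 0 · g (suc k) + conv (f ∘ suc) g k

conv-cong : ∀ {f f′} g → (∀ i → f i ≡ f′ i) → ∀ k → conv f g k ≡ conv f′ g k
conv-cong g f≈f′ zero    = cong (_· g 0) (f≈f′ 0)
conv-cong g f≈f′ (suc k) =
  cong₂ (λ x y → x · g (suc k) + y) (f≈f′ 0) (conv-cong g (f≈f′ ∘ suc) k)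

conv-+ : ∀ f f′ g k → conv (λ i → f i + f′ i) g k ≡ conv f g k + conv f′ g k
conv-+ f f′ g zero    = ℤ.*-distribʳ-+ (g 0) (f 0) (f′ 0)
conv-+ f f′ g (suc k) = modulo 1ℤ (conv-+ (f ∘ suc) (f′ ∘ suc) g k)
  (ring (f 0) (f′ 0) (g (suc k)) (conv (f ∘ suc) g k) (conv (f′ ∘ suc) g k)
    (conv (λ i → f (suc i) + f′ (suc i)) g k))
  where
  ring : ∀ a b g x y z → (a + b) · g + z ≡ a · g + x + (b · g + y) + 1ℤ · (z - (x + y))
  ring = solve-∀

conv-zero : ∀ f g → (∀ i → f i ≡ 0ℤ) → ∀ k → conv f g k ≡ 0ℤ
conv-zero f g f≈0 zero    rewrite f≈0 0 = ℤ.*-zeroˡ (g 0)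
conv-zero f g f≈0 (suc k) rewrite f≈0 0 | conv-zero (f ∘ suc) g (f≈0 ∘ suc) k =
  trans (ℤ.+-identityʳ _) (ℤ.*-zeroˡ (g (suc k)))

conv-head : ∀ f g → (∀ i → f (suc i) ≡ 0ℤ) → ∀ k → conv f g k ≡ f 0 · g k
conv-head f g f≈0 zero    = refl
conv-head f g f≈0 (suc k) rewrite conv-zero (f ∘ suc) g f≈0 k = ℤ.+-identityʳ _

-- Induction on m: Pascal applied to the first factor splits the convolution into those for m at k
-- and at k+1.
vandermonde : ∀ m n k → conv (bin m) (bin n) k ≡ bin (m ℕ.+ n) k
vandermonde zero n k = begin
  conv (bin 0) (bin n) k  ≡⟨ conv-head (bin 0) (bin n) (λ i → bin-small (s≤s z≤n)) k ⟩
  bin 0 0 · bin n k       ≡⟨ cong (_· bin n k) (bin-zero 0) ⟩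
  1ℤ · bin n k            ≡⟨ ℤ.*-identityˡ _ ⟩
  bin n k                 ∎
  where open ≡-Reasoning
vandermonde (suc m) n zero
  rewrite bin-zero (suc m) | bin-zero n | bin-zero (suc m ℕ.+ n) = refl
vandermonde (suc m) n (suc k) = begin
  bin (suc m) 0 · bin n (suc k) + conv (bin (suc m) ∘ suc) (bin n) k
    ≡⟨ cong₂ (λ x y → x · bin n (suc k) + y) (trans (bin-zero (suc m)) (sym (bin-zero m)))
         (trans (conv-cong (bin n) (pascal m) k) (conv-+ (bin m) (bin m ∘ suc) (bin n) k)) ⟩
  bin m 0 · bin n (suc k) + (conv (bin m) (bin n) k + conv (bin m ∘ suc) (bin n) k)
    ≡⟨ ring (bin m 0 · bin n (suc k)) (conv (bin m) (bin n) k) (conv (bin m ∘ suc) (bin n) k) ⟩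
  conv (bin m) (bin n) k + conv (bin m) (bin n) (suc k)
    ≡⟨ cong₂ _+_ (vandermonde m n k) (vandermonde m n (suc k)) ⟩
  bin (m ℕ.+ n) k + bin (m ℕ.+ n) (suc k)
    ≡⟨ pascal (m ℕ.+ n) k ⟨
  bin (suc m ℕ.+ n) (suc k) ∎
  where
  open ≡-Reasoning
  ring : ∀ a x y → a + (x + y) ≡ x + (a + y)
  ring = solve-∀

-- Reduction of sums modulo an integer

∣-cong : ∀ {m x y} → x ≡ y → m ∣ x → m ∣ y
∣-cong {m} = subst (m ∣_)

∣0 : ∀ m → m ∣ 0ℤ
∣0 m = divides 0ℤ refl

-- The difference consists of the first a products, each a multiple of m. Writing the total index as
-- a + k makes the remainder a convolution again.
conv-drop : ∀ m f g a k → (∀ i j → i ℕ.+ j ≡ a ℕ.+ k → i ℕ.< a → m ∣ f i · g j) →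
  m ∣ conv f g (a ℕ.+ k) - conv (λ i → f (a ℕ.+ i)) g k
conv-drop m f g zero    k d = ∣-cong (sym (ℤ.+-inverseʳ (conv f g k))) (∣0 m)
conv-drop m f g (suc a) k d = ∣-cong (ring (f 0 · g (suc (a ℕ.+ k))) _ _)
  (∣m∣n⇒∣m+n (d 0 (suc (a ℕ.+ k)) refl (s≤s z≤n))
    (conv-drop m (f ∘ suc) g a k (λ i j e i<a → d (suc i) j (cong suc e) (s≤s i<a))))
  where
  ring : ∀ x y z → x + (y - z) ≡ x + y - z
  ring = solve-∀

-- Only the term i = 0 survives modulo m, and it carries the weight 4^n.
centralSum-head : ∀ m f n → (∀ i → suc i ℕ.≤ n → m ∣ f (suc i)) →
  m ∣ centralSum f (suc n) - f 0 · (+ 4) ^ n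
centralSum-head m f zero d rewrite bin-zero 0 = ∣-cong (sym (ring (f 0))) (∣0 m)
  where
  ring : ∀ x → + 4 · 0ℤ + 1ℤ · x - x · 1ℤ ≡ 0ℤ
  ring = solve-∀
centralSum-head m f (suc n) d = ∣-cong
  (ring (centralSum f (suc n)) (f 0) ((+ 4) ^ n) (central (suc n) · f (suc n)))
  (∣m∣n⇒∣m+n
    (∣n⇒∣m*n (+ 4) (centralSum-head m f n (λ i i<n → d i (ℕ.m≤n⇒m≤1+n i<n))))
    (∣n⇒∣m*n (central (suc n)) (d n ℕ.≤-refl)))
  where
  ring : ∀ s x e y → + 4 · (s - x · e) + y ≡ + 4 · s + y - x · (+ 4 · e)
  ring = solve-∀

centralSum-linear : ∀ a f g n →
  centralSum (λ i → f i + a · g i) n ≡ centralSum f n + a · centralSum g n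
centralSum-linear a f g zero    = sym (trans (ℤ.+-identityˡ _) (ℤ.*-zeroʳ a))
centralSum-linear a f g (suc n) = modulo (+ 4) (centralSum-linear a f g n)
  (ring a (centralSum f n) (centralSum g n) (centralSum (λ i → f i + a · g i) n) (central n) (f n) (g n))
  where
  ring : ∀ a s t u c x y → + 4 · u + c · (x + a · y)
    ≡ + 4 · s + c · x + a · (+ 4 · t + c · y) + + 4 · (u - (s + a · t))
  ring = solve-∀

-- Rising factorials with negative parameter

-- alternating n i = (-n)ᵢ / i!
alternating : ℕ → ℕ → ℤ
alternating n i = (- 1ℤ) ^ i · bin n i

alternating-zero : ∀ n → alternating n 0 ≡ 1ℤ
alternating-zero n rewrite bin-zero n = refl

alternating-small : ∀ {n k} → n ℕ.< k → alternating n k ≡ 0ℤ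
alternating-small {n} {k} n<k rewrite bin-small n<k = ℤ.*-zeroʳ ((- 1ℤ) ^ k)

-- The parameter rises from -(n+1) to -n, so in `contiguity` the role of `h` falls to
-- `alternating (suc n)` and that of `h′` to `alternating n`.
alternating-pascal : ∀ n i → alternating n (suc i) ≡ alternating n i + alternating (suc n) (suc i)
alternating-pascal n i = modulo ((- 1ℤ) ^ i) (pascal n i)
  (ring ((- 1ℤ) ^ i) (bin n i) (bin n (suc i)) (bin (suc n) (suc i)))
  where
  ring : ∀ s x y z → - 1ℤ · s · y ≡ s · x + - 1ℤ · s · z + s · (z - (x + y))
  ring = solve-∀

alternating-absorb : ∀ n i → + suc i · alternating n (suc i) ≡ (+ i - + n) · alternating n i
alternating-absorb n i = modulo (- ((- 1ℤ) ^ i)) (bin-step n i)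
  (ring ((- 1ℤ) ^ i) (+ n) (+ i) (bin n i) (bin n (suc i)))
  where
  ring : ∀ s n i x y → (1ℤ + i) · (- 1ℤ · s · y)
    ≡ (i - n) · (s · x) + - s · ((1ℤ + i) · y - (n - i) · x)
  ring = solve-∀

-- The Chu-Vandermonde evaluation ₂F₁(1/2,-a;1;1) = c(a)/4^a with denominators cleared. Contiguity
-- at b = -(a+1) has no boundary term because a < n, so passing from a to a+1 multiplies the sum by
-- (2a+1)/(2a+2), as it does c(a)/4^a.
alternating-sum : ∀ n a → a ℕ.≤ n →
  (+ 4) ^ a · centralSum (alternating a) (suc n) ≡ central a · (+ 4) ^ n
alternating-sum n zero _ = cong₂ _·_ (sym (bin-zero 0)) (begin
  centralSum (alternating 0) (suc n)
    -- Divisibility by 0 is used as equality: every term with i > 0 vanishes exactly.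
    ≡⟨ ℤ.i-j≡0⇒i≡j _ _ (0∣⇒≡0 (centralSum-head 0ℤ (alternating 0) n
         (λ i _ → divides 0ℤ (alternating-small {0} {suc i} (s≤s z≤n))))) ⟩
  alternating 0 0 · (+ 4) ^ n         ≡⟨ cong (_· (+ 4) ^ n) (alternating-zero 0) ⟩
  1ℤ · (+ 4) ^ n                      ≡⟨ ℤ.*-identityˡ _ ⟩
  (+ 4) ^ n                           ∎)
  where open ≡-Reasoning
alternating-sum n (suc a) a<n = ℤ.*-cancelˡ-≡ (+ suc a) _ _
  (modulo ((+ 4) ^ a · + 2)
    (contiguity (- + suc a) (alternating (suc a)) (alternating a)
      (alternating-zero (suc a)) (alternating-zero a) (alternating-pascal a)
      (λ i → trans (alternating-absorb a i) (cong (_· alternating a i) (shift (+ a) (+ i)))) n)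
  (modulo (+ 2 · (+ 4) ^ a · (+ 2 · + n + 1ℤ) · central n) (alternating-small a<n)
  (modulo (+ 2 · (+ 2 · + a + 1ℤ)) (alternating-sum n a (ℕ.<⇒≤ a<n))
  (modulo (- ((+ 4) ^ n)) (central-suc a)
    (ring (+ a) (+ n) ((+ 4) ^ a) ((+ 4) ^ n) (central a) (central (suc a)) (central n)
      (alternating a n) (centralSum (alternating a) (suc n))
      (centralSum (alternating (suc a)) (suc n)))))))
  where
  shift : ∀ a i → i - a ≡ 1ℤ + - (1ℤ + a) + i
  shift = solve-∀
  ring : ∀ a n x y c d cn h s t →
    (1ℤ + a) · (+ 4 · x · t) ≡ (1ℤ + a) · (d · y)
      + x · + 2 · ((+ 2 · - (1ℤ + a) + 1ℤ) · s - (+ 2 · - (1ℤ + a) · t + (+ 2 · n + 1ℤ) · cn · h))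
      + + 2 · x · (+ 2 · n + 1ℤ) · cn · (h - 0ℤ)
      + + 2 · (+ 2 · a + 1ℤ) · (x · s - c · y)
      + - y · ((1ℤ + a) · d - + 2 · (+ 2 · a + 1ℤ) · c)
  ring = solve-∀

-- Binomial coefficients and rising factorials modulo p and p²

prime-cancel : ∀ {p i x} → Prime p → ¬ (p ℕ.∣ i) → + p ∣ + i · x → + p ∣ x
prime-cancel {p} {i} {x} pr p∤i d
  with euclidsLemma i ∣ x ∣ pr (subst (p ℕ.∣_) (ℤ.abs-* (+ i) x) (∣⇒∣ᵤ d))
... | inj₁ p∣i = ⊥-elim (p∤i p∣i)
... | inj₂ p∣x = ∣ᵤ⇒∣ p∣x

-- Euclid's lemma twice: first x = q p, then, after cancelling this p, p divides q.
prime²-cancel : ∀ {p i x} → Prime p → ¬ (p ℕ.∣ i) → + p · + p ∣ + i · x → + p · + p ∣ x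
prime²-cancel {p} {i} {x} pr p∤i d
  with prime-cancel {x = x} pr p∤i (∣-trans (divides (+ p) refl) d)
... | divides q refl = *-monoˡ-∣ (+ p) (prime-cancel {x = q} pr p∤i
        (*-cancelʳ-∣ (+ p) {{prime⇒nonZero pr}} (∣-cong (sym (ℤ.*-assoc (+ i) q (+ p))) d)))

prime∤[suc] : ∀ {p i} → suc i ℕ.< p → ¬ (p ℕ.∣ suc i)
prime∤[suc] i<p p∣i = ℕ.<⇒≱ i<p (ℕ.∣⇒≤ p∣i)

-- By absorption j C(n,j) = n C(n-1,j-1), where p divides n but not j.
prime∣bin : ∀ {p} → Prime p → ∀ n j → p ℕ.∣ n → ¬ (p ℕ.∣ j) → + p ∣ bin n j
prime∣bin {p} pr n       zero    p∣n p∤j = ⊥-elim (p∤j (p ℕ.∣0))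
prime∣bin {p} pr zero    (suc j) p∣n p∤j = ∣-cong (sym (bin-small (s≤s z≤n))) (∣0 (+ p))
prime∣bin {p} pr (suc n) (suc j) p∣n p∤j = prime-cancel pr p∤j
  (∣-cong (sym (bin-absorb n j)) (∣m⇒∣m*n {m = + suc n} (bin n j) (∣ᵤ⇒∣ p∣n)))

∣-product : ∀ {m x y} → m ∣ x → m ∣ y → m · m ∣ x · y
∣-product {m} (divides q refl) (divides r refl) = divides (q · r) (ring q r m)
  where
  ring : ∀ q r m → q · m · (r · m) ≡ q · r · (m · m)
  ring = solve-∀

-- In Vandermonde's sum for C(p+n, p+q) the inner terms are products of two multiples of p.
bin-prime-step : ∀ {p} → Prime p → ∀ x y →
  + p · + p ∣ bin (p ℕ.+ x * p) (p ℕ.+ y * p) - (bin (x * p) (p ℕ.+ y * p) + bin (x * p) (y * p))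
bin-prime-step {zero}  pr = ⊥-elim (¬prime[0] pr)
bin-prime-step {suc r} pr x y = ∣-cong
  (begin
    conv (f ∘ suc) g (r ℕ.+ q) - conv (λ i → f (p ℕ.+ i)) g q
      ≡⟨ cong (λ z → conv (f ∘ suc) g (r ℕ.+ q) - z) last ⟩
    conv (f ∘ suc) g (r ℕ.+ q) - g q
      ≡⟨ ring (g (p ℕ.+ q)) (conv (f ∘ suc) g (r ℕ.+ q)) (g q) ⟩
    1ℤ · g (p ℕ.+ q) + conv (f ∘ suc) g (r ℕ.+ q) - (g (p ℕ.+ q) + g q)
      ≡⟨ cong (λ z → z · g (p ℕ.+ q) + conv (f ∘ suc) g (r ℕ.+ q) - (g (p ℕ.+ q) + g q)) (bin-zero p) ⟨
    conv f g (p ℕ.+ q) - (g (p ℕ.+ q) + g q)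
      ≡⟨ cong (_- (g (p ℕ.+ q) + g q)) (vandermonde p (x * p) (p ℕ.+ q)) ⟩
    bin (p ℕ.+ x * p) (p ℕ.+ q) - (g (p ℕ.+ q) + g q) ∎)
  (conv-drop (+ p · + p) (f ∘ suc) g r q inner)
  where
  open ≡-Reasoning
  p q : ℕ
  p = suc r
  q = y * p
  f g : ℕ → ℤ
  f = bin p
  g = bin (x * p)
  last : conv (λ i → f (p ℕ.+ i)) g q ≡ g q
  last = begin
    conv (λ i → f (p ℕ.+ i)) g q  ≡⟨ conv-head (λ i → f (p ℕ.+ i)) g
                                        (λ i → bin-small (ℕ.m<m+n p (s≤s z≤n))) q ⟩
    f (p ℕ.+ 0) · g q             ≡⟨ cong (λ k → f k · g q) (ℕ.+-identityʳ p) ⟩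
    f p · g q                     ≡⟨ cong (_· g q) (bin-self p) ⟩
    1ℤ · g q                      ≡⟨ ℤ.*-identityˡ (g q) ⟩
    g q                           ∎
  inner : ∀ i j → i ℕ.+ j ≡ r ℕ.+ q → i ℕ.< r → + p · + p ∣ f (suc i) · g j
  inner i j e i<r = ∣-product
    (prime∣bin pr p (suc i) ℕ.∣-refl (prime∤[suc] (s≤s i<r)))
    -- The indices i+1 and j add up to the multiple p + yp of p, and p does not divide i+1; hence it
    -- does not divide j.
    (prime∣bin pr (x * p) j (ℕ.n∣m*n x) (λ p∣j → prime∤[suc] {i = i} (s≤s i<r)
      (ℕ.∣m+n∣m⇒∣n (subst (p ℕ.∣_) (trans (cong suc (sym e)) (ℕ.+-comm (suc i) j))
        (ℕ.n∣m*n (suc y))) p∣j)))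
  ring : ∀ a b c → b - c ≡ 1ℤ · a + b - (a + c)
  ring = solve-∀

-- Modulo p², C(xp,yp) obeys Pascal's rule in x and y, with the same boundary values as C(x,y).
bin-prime : ∀ {p} → Prime p → ∀ x y → + p · + p ∣ bin (x * p) (y * p) - bin x y
bin-prime {p} pr x zero rewrite bin-zero (x * p) | bin-zero x = ∣0 (+ p · + p)
bin-prime {p} pr zero (suc y)
  rewrite bin-small {0} {suc y * p}
            (ℕ.>-nonZero⁻¹ (suc y * p) {{ℕ.m*n≢0 (suc y) p {{_}} {{prime⇒nonZero pr}}}})
        | bin-small {0} {suc y} (s≤s z≤n) = ∣0 (+ p · + p)
bin-prime {p} pr (suc x) (suc y) = ∣-cong
  (modulo 1ℤ (pascal x y)
    (ring (bin (suc x * p) (suc y * p)) (bin (x * p) (suc y * p)) (bin (x * p) (y * p))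
      (bin x (suc y)) (bin x y) (bin (suc x) (suc y))))
  (∣m∣n⇒∣m+n (bin-prime-step pr x y) (∣m∣n⇒∣m+n (bin-prime pr x (suc y)) (bin-prime pr x y)))
  where
  ring : ∀ a b c d e f → a - (b + c) + (b - d + (c - e)) ≡ a - f + 1ℤ · (f - (e + d))
  ring = solve-∀

-- For 0 < i < p, (2p)ᵢ / i! ≡ 2p/i and (-p)ᵢ / i! ≡ -p/i (mod p²).
opposite-symbols : ∀ r → Prime (suc r) → ∀ i → i ℕ.< suc r →
  let p = + suc r; h = multichoose (suc (2 * r)); a = alternating (suc r) in
  (p · p ∣ + i · (h i + + 2 · a i)) × (p ∣ h i - a i)
-- The factor `+ i` matters here: `h 0` + 2 `a 0` is 3.
opposite-symbols r pr zero _
  rewrite bin-zero (suc (2 * r) ℕ.+ 0) | alternating-zero (suc r) =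
  divides 0ℤ refl , divides 0ℤ refl
opposite-symbols r pr (suc i) i<r with opposite-symbols r pr i (ℕ.<-trans ℕ.≤-refl i<r)
... | sum , difference =
  -- Multiplied by i+1, the new sum is i (h + 2a) + 2p (h - a), so the congruence modulo p² at i+1
  -- needs the one modulo p at i; hence the joint induction.
  ∣-cong
    (modulo (- 1ℤ) stepₕ (modulo (- + 2) stepₐ (ring₁ (+ i) p (h i) (a i) (h (suc i)) (a (suc i)))))
    (∣m∣n⇒∣m+n sum (∣n⇒∣m*n (+ 2) (*-monoʳ-∣ p difference))) ,
  prime-cancel pr (prime∤[suc] i<r)
    (∣-cong
      (modulo (- 1ℤ) stepₕ (modulo 1ℤ stepₐ (ring₂ (+ i) p (h i) (a i) (h (suc i)) (a (suc i)))))
      (∣m∣n⇒∣m+n (∣n⇒∣m*n (+ i) difference) (divides (+ 2 · h i + a i) refl)))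
  where
  p : ℤ
  p = + suc r
  h a : ℕ → ℤ
  h = multichoose (suc (2 * r))
  a = alternating (suc r)
  stepₕ : + suc i · h (suc i) ≡ (+ 2 · p + + i) · h i
  stepₕ = trans (multichoose-absorb (suc (2 * r)) i)
    (cong (λ k → (k + + i) · h i) (trans (cong +_ (sym (ℕ.*-suc 2 r))) (ℤ.pos-* 2 (suc r))))
  stepₐ : + suc i · a (suc i) ≡ (+ i - p) · a i
  stepₐ = alternating-absorb (suc r) i
  ring₁ : ∀ i p x y x′ y′ → i · (x + + 2 · y) + + 2 · (p · (x - y))
    ≡ (1ℤ + i) · (x′ + + 2 · y′)
      + - 1ℤ · ((1ℤ + i) · x′ - (+ 2 · p + i) · x) + - + 2 · ((1ℤ + i) · y′ - (i - p) · y)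
  ring₁ = solve-∀
  ring₂ : ∀ i p x y x′ y′ → i · (x - y) + (+ 2 · x + y) · p
    ≡ (1ℤ + i) · (x′ - y′)
      + - 1ℤ · ((1ℤ + i) · x′ - (+ 2 · p + i) · x) + 1ℤ · ((1ℤ + i) · y′ - (i - p) · y)
  ring₂ = solve-∀

-- Parity of p and powers of 2, 4 and 64

alternating-sign : ∀ n → (2 ℕ.∣ n × (- 1ℤ) ^ n ≡ 1ℤ) ⊎ (2 ℕ.∣ suc n × (- 1ℤ) ^ n ≡ - 1ℤ)
alternating-sign zero = inj₁ (2 ℕ.∣0 , refl)
alternating-sign (suc n) with alternating-sign n
... | inj₁ (2∣n , e)   = inj₂ (ℕ.∣m∣n⇒∣m+n ℕ.∣-refl 2∣n , cong (- 1ℤ ·_) e)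
... | inj₂ (2∣1+n , e) = inj₁ (2∣1+n , cong (- 1ℤ ·_) e)

odd-prime-sign : ∀ {p} → Prime p → ¬ (p ≡ 2) → (- 1ℤ) ^ p ≡ - 1ℤ
odd-prime-sign {zero}  pr p≢2 = ⊥-elim (¬prime[0] pr)
odd-prime-sign {suc r} pr p≢2 with alternating-sign r
... | inj₁ (_ , e) = cong (- 1ℤ ·_) e
... | inj₂ (2∣p , _) with prime⇒irreducible pr 2∣p
...   | inj₂ 2≡p = ⊥-elim (p≢2 (sym 2≡p))

odd-prime∤2^ : ∀ {p} → Prime p → ¬ (p ≡ 2) → ∀ k → ¬ (p ℕ.∣ 2 ℕ.^ k)
odd-prime∤2^ pr p≢2 zero    p∣1 = ¬prime[1] (subst Prime (ℕ.∣1⇒≡1 p∣1) pr)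
odd-prime∤2^ pr p≢2 (suc k) p∣  with euclidsLemma 2 (2 ℕ.^ k) pr p∣
... | inj₂ p∣2^k = odd-prime∤2^ pr p≢2 k p∣2^k
... | inj₁ p∣2 with prime⇒irreducible prime[2] p∣2
...   | inj₁ p≡1 = ¬prime[1] (subst Prime p≡1 pr)
...   | inj₂ p≡2 = p≢2 p≡2

odd-prime∤64^ : ∀ {p} → Prime p → ¬ (p ≡ 2) → ∀ k → ¬ (p ℕ.∣ 64 ℕ.^ k)
odd-prime∤64^ {p} pr p≢2 k p∣ =
  odd-prime∤2^ pr p≢2 (6 * k) (subst (p ℕ.∣_) (ℕ.^-*-assoc 2 6 k) p∣)

4^n≢0 : ∀ n → IntegerNonZero ((+ 4) ^ n)
4^n≢0 zero    = _
4^n≢0 (suc n) = ℤ.i*j≢0 (+ 4) ((+ 4) ^ n) {{_}} {{4^n≢0 n}}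

64^n≡[4^n]³ : ∀ n → (+ 64) ^ n ≡ (+ 4) ^ n · ((+ 4) ^ n · (+ 4) ^ n)
64^n≡[4^n]³ zero    = refl
64^n≡[4^n]³ (suc n) = modulo (+ 64) (64^n≡[4^n]³ n) (ring ((+ 4) ^ n) ((+ 64) ^ n))
  where
  ring : ∀ e x → + 64 · x ≡ + 4 · e · (+ 4 · e · (+ 4 · e)) + + 64 · (x - e · (e · e))
  ring = solve-∀

-- The congruence for the numerator

-- At a = n = p, `alternating-sum` has the top term -c(p), as p is odd. Splitting it off leaves 4
-- R(-p,p) - c(p) = c(p).
alternating-sum-prime : ∀ {p} → Prime p → ¬ (p ≡ 2) →
  + 2 · centralSum (alternating p) p ≡ central p
alternating-sum-prime {p} pr p≢2 = ℤ.*-cancelˡ-≡ (+ 2) _ _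
  (modulo 1ℤ total
  (modulo (- (central p)) top
    (ring (centralSum (alternating p) p) (central p) (alternating p p))))
  where
  total : centralSum (alternating p) (suc p) ≡ central p
  total = ℤ.*-cancelˡ-≡ ((+ 4) ^ p) _ _ {{4^n≢0 p}}
    (trans (alternating-sum p p ℕ.≤-refl) (ℤ.*-comm (central p) ((+ 4) ^ p)))
  top : alternating p p ≡ - 1ℤ
  top rewrite bin-self p = trans (ℤ.*-identityʳ _) (odd-prime-sign pr p≢2)
  ring : ∀ s c a → + 2 · (+ 2 · s) ≡ + 2 · c
    + 1ℤ · (+ 4 · s + c · a - c) + - c · (a - - 1ℤ)
  ring = solve-∀

central-prime : ∀ {p} → Prime p → + p · + p ∣ central p - + 2
central-prime {p} pr = ∣-cong
  (cong₂ _-_ (cong (bin (2 * p)) (ℕ.*-identityˡ p)) (bin-def 2 1)) (bin-prime pr 2 1)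

central-double-prime : ∀ {p} → Prime p → + p · + p ∣ central (2 * p) - + 6
central-double-prime {p} pr = ∣-cong
  (cong₂ _-_ (cong (λ k → bin k (2 * p)) (ℕ.*-assoc 2 2 p)) (bin-def 4 2)) (bin-prime pr 4 2)

-- In the combination (2p)ᵢ/i! + 2 (-p)ᵢ/i! all terms with 0 < i < p vanish modulo p², and the term
-- i = 0 is 3.
multichoose-sum-prime : ∀ r → Prime (suc r) → + suc r · + suc r ∣
  centralSum (multichoose (suc (2 * r))) (suc r) + + 2 · centralSum (alternating (suc r)) (suc r)
  - + 3 · (+ 4) ^ r
multichoose-sum-prime r pr = ∣-cong
  (cong₂ _-_ (centralSum-linear (+ 2) h a (suc r))
    (cong (_· (+ 4) ^ r) (cong₂ (λ x y → x + + 2 · y)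
      (bin-zero (suc (2 * r) ℕ.+ 0)) (alternating-zero (suc r)))))
  (centralSum-head (+ suc r · + suc r) (λ i → h i + + 2 · a i) r
    (λ i i<r → prime²-cancel pr (prime∤[suc] (s≤s i<r))
      (proj₁ (opposite-symbols r pr (suc i) (s≤s i<r)))))
  where
  h a : ℕ → ℤ
  h = multichoose (suc (2 * r))
  a = alternating (suc r)

alternating-sum-mod : ∀ r → Prime (suc r) →
  + suc r ∣ centralSum (alternating (suc r)) (suc r) - (+ 4) ^ r
alternating-sum-mod r pr = ∣-cong
  (cong (λ x → centralSum (alternating (suc r)) (suc r) - x)
    (trans (cong (_· (+ 4) ^ r) (alternating-zero (suc r))) (ℤ.*-identityˡ ((+ 4) ^ r))))
  (centralSum-head (+ suc r) (alternating (suc r)) r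
    (λ i i<r → ∣n⇒∣m*n ((- 1ℤ) ^ suc i)
      (prime∣bin pr (suc r) (suc i) ℕ.∣-refl (prime∤[suc] (s≤s i<r)))))

partialNum-cong : ∀ r → Prime (suc r) → ¬ (suc r ≡ 2) →
  (+ suc r) ^ 3 ∣ partialNum r - + 9 · + suc r · (+ 64) ^ suc r
partialNum-cong r pr p≢2 = ∣-cong
  -- The numerator has an explicit factor p, so its cofactor matters only modulo p². As 576 = 9 · 64
  -- and e³ = 64^(p-1), the target 9p · 64^p is 576 p e³.
  (modulo (+ 576 · p) (64^n≡[4^n]³ r) (ring₃ p v e cc ((+ 64) ^ r)))
  (subst (_∣ p · (+ 96 · cc · v - + 576 · (e · (e · e)))) (cube p) (*-monoʳ-∣ p bracket))
  where
  p v w e c cc : ℤ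
  p = + suc r
  v = centralSum (multichoose (suc (2 * r))) (suc r)
  w = centralSum (alternating (suc r)) (suc r)
  e = (+ 4) ^ r
  c = central (suc r)
  cc = central (2 * suc r)

  -- Fermat's congruence for 4, from 2e ≡ 2w = c(p) ≡ 2 (mod p) with the 2 cancelled.
  p∣e-1 : p ∣ e - 1ℤ
  p∣e-1 = prime-cancel pr (odd-prime∤2^ pr p≢2 1)
    (∣-cong (modulo (- 1ℤ) (alternating-sum-prime pr p≢2) (ring₁ w e c))
      (∣m∣n⇒∣m-n (∣-trans (divides p refl) (central-prime pr))
        (∣n⇒∣m*n (+ 2) (alternating-sum-mod r pr))))
    where
    ring₁ : ∀ w e c → c - + 2 - + 2 · (w - e) ≡ + 2 · (e - 1ℤ) + - 1ℤ · (+ 2 · w - c)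
    ring₁ = solve-∀

  -- Since e ≡ 1 (mod p), e³ ≡ 3e - 2 (mod p²).
  bracket : p · p ∣ + 96 · cc · v - + 576 · (e · (e · e))
  bracket = ∣-cong (modulo (+ 576) (alternating-sum-prime pr p≢2) (ring₂ v w e c cc))
    (∣m∣n⇒∣m-n
      (∣m∣n⇒∣m+n (∣n⇒∣m*n (+ 96 · v) (central-double-prime pr))
        (∣n⇒∣m*n (+ 576) (∣m∣n⇒∣m-n (multichoose-sum-prime r pr) (central-prime pr))))
      (∣n⇒∣m*n (+ 576 · (e + + 2)) (∣-product p∣e-1 p∣e-1)))
    where
    ring₂ : ∀ v w e c cc →
      + 96 · v · (cc - + 6) + + 576 · (v + + 2 · w - + 3 · e - (c - + 2))
        - + 576 · (e + + 2) · ((e - 1ℤ) · (e - 1ℤ))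
      ≡ + 96 · cc · v - + 576 · (e · (e · e)) + + 576 · (+ 2 · w - c)
    ring₂ = solve-∀

  cube : ∀ p → p · (p · p) ≡ p ^ 3
  cube p = cong (λ x → p · (p · x)) (sym (ℤ.*-identityʳ p))

  ring₃ : ∀ p v e cc x → p · (+ 96 · cc · v - + 576 · (e · (e · e)))
    ≡ + 96 · p · cc · v - + 9 · p · (+ 64 · x) + + 576 · p · (x - e · (e · e))
  ring₃ = solve-∀

-- Passage to rational numbers

toℚᵘ-/ : ∀ i n .{{_ : NonZero n}} → toℚᵘ (i / n) ≃ (i ℚᵘ./ n)
toℚᵘ-/ i (suc n) = ℚ.toℚᵘ-fromℚᵘ (mkℚᵘ i n)

-- The second summand is a product with an integer because `term` has that shape.
/-add : ∀ a b c d e f g .{{_ : NonZero b}} .{{_ : NonZero d}} .{{_ : NonZero g}} →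
  (a · + d + c · e · + b) · + g ≡ f · (+ b · + d) →
  (a / b) ℚ.+ (c / d) ℚ.* (e / 1) ≡ f / g
/-add a (suc b) c (suc d) e f (suc g) eq = ℚ.toℚᵘ-injective (begin
  toℚᵘ ((a / suc b) ℚ.+ (c / suc d) ℚ.* (e / 1))
    ≈⟨ ℚ.toℚᵘ-homo-+ (a / suc b) ((c / suc d) ℚ.* (e / 1)) ⟩
  toℚᵘ (a / suc b) ℚᵘ.+ toℚᵘ ((c / suc d) ℚ.* (e / 1))
    ≈⟨ ℚᵘ.+-cong (toℚᵘ-/ a (suc b)) (ℚᵘ.≃-trans (ℚ.toℚᵘ-homo-* (c / suc d) (e / 1))
         (ℚᵘ.*-cong (toℚᵘ-/ c (suc d)) (toℚᵘ-/ e 1))) ⟩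
  mkℚᵘ a b ℚᵘ.+ mkℚᵘ c d ℚᵘ.* mkℚᵘ e 0
    ≈⟨ *≡* (trans
         (cong (λ x → (a · + x + c · e · + suc b) · + suc g) (ℕ.*-identityʳ (suc d)))
         (trans eq (cong (λ x → f · + (suc b * x)) (sym (ℕ.*-identityʳ (suc d)))))) ⟩
  mkℚᵘ f g
    ≈⟨ toℚᵘ-/ f (suc g) ⟨
  toℚᵘ (f / suc g) ∎)
  where open ℚᵘ.≃-Reasoning

/-sub : ∀ a b c k u .{{_ : NonZero b}} → a - c · + b ≡ k · u →
  (a / b) ℚ.- (c / 1) ≡ (k / 1) ℚ.* (u / b)
/-sub a (suc b) c k u eq = ℚ.toℚᵘ-injective (begin
  toℚᵘ ((a / suc b) ℚ.- (c / 1))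
    ≈⟨ ℚ.toℚᵘ-homo-+ (a / suc b) (ℚ.- (c / 1)) ⟩
  toℚᵘ (a / suc b) ℚᵘ.+ toℚᵘ (ℚ.- (c / 1))
    ≈⟨ ℚᵘ.+-cong (toℚᵘ-/ a (suc b))
         (ℚᵘ.≃-trans (ℚ.toℚᵘ-homo‿- (c / 1)) (ℚᵘ.-‿cong (toℚᵘ-/ c 1))) ⟩
  mkℚᵘ a b ℚᵘ.+ ℚᵘ.- mkℚᵘ c 0
    ≈⟨ *≡* (cong₂ _·_
         (trans (ring a c (+ suc b)) eq)
         (cong +_ (trans (ℕ.*-identityˡ (suc b)) (sym (ℕ.*-identityʳ (suc b)))))) ⟩
  mkℚᵘ k 0 ℚᵘ.* mkℚᵘ u b
    ≈⟨ ℚᵘ.*-cong (toℚᵘ-/ k 1) (toℚᵘ-/ u (suc b)) ⟨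
  toℚᵘ (k / 1) ℚᵘ.* toℚᵘ (u / suc b)
    ≈⟨ ℚ.toℚᵘ-homo-* (k / 1) (u / suc b) ⟨
  toℚᵘ ((k / 1) ℚ.* (u / suc b)) ∎)
  where
  open ℚᵘ.≃-Reasoning
  ring : ∀ a c b → a · 1ℤ + - c · b ≡ a - c · b
  ring = solve-∀

pos-quadratic : ∀ a b c n →
  + (a * n * n ℕ.+ b * n ℕ.+ c) ≡ + a · + n · + n + + b · + n + + c
pos-quadratic a b c n = cong (λ x → x + + c) (cong₂ _+_
  (trans (ℤ.pos-* (a * n) n) (cong (_· + n) (ℤ.pos-* a n))) (ℤ.pos-* b n))

-- C(3n,n) is (2n+1)ₙ/n!, the form in which it arises from contiguity.
pos-binomials : ∀ n → + (((2 * n) C n) * ((3 * n) C n) * ((4 * n) C (2 * n)))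
  ≡ central n · multichoose (2 * n) n · central (2 * n)
pos-binomials n = begin
  + (((2 * n) C n) * ((3 * n) C n) * ((4 * n) C (2 * n)))
    ≡⟨ trans (ℤ.pos-* (((2 * n) C n) * ((3 * n) C n)) _)
         (cong (_· + ((4 * n) C (2 * n))) (ℤ.pos-* ((2 * n) C n) _)) ⟩
  + ((2 * n) C n) · + ((3 * n) C n) · + ((4 * n) C (2 * n))
    ≡⟨ cong₂ _·_ (cong₂ _·_ (bin-def (2 * n) n) (bin-def (3 * n) n)) (bin-def (4 * n) (2 * n)) ⟨
  bin (2 * n) n · bin (3 * n) n · bin (4 * n) (2 * n)
    ≡⟨ cong₂ (λ x y → bin (2 * n) n · bin x n · bin y (2 * n))
         (ℕ.+-comm n (2 * n)) (ℕ.*-assoc 2 2 n) ⟩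
  central n · multichoose (2 * n) n · central (2 * n) ∎
  where open ≡-Reasoning

pos-^ : ∀ a n → + (a ℕ.^ n) ≡ (+ a) ^ n
pos-^ a zero    = refl
pos-^ a (suc n) = trans (ℤ.pos-* a (a ℕ.^ n)) (cong (+ a ·_) (pos-^ a n))

-- After cross-multiplication the claim is the hypothesis times 64^(2n).
add-term : ∀ n a b →
  (+ 2 · + n + 1ℤ) · b ≡ + 64 · ((+ 2 · + n + 1ℤ) · a
    + weight (+ n) · (central n · multichoose (2 * n) n · central (2 * n))) →
  (a / 64 ℕ.^ n) {{m^n≢0 64 n}} ℚ.+ term n ≡ (b / 64 ℕ.^ suc n) {{m^n≢0 64 (suc n)}}
add-term n a b step =
  /-add a (64 ℕ.^ n) w (den n) u b (64 ℕ.^ suc n)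
    {{m^n≢0 64 n}} {{den≢0 n}} {{m^n≢0 64 (suc n)}}
    (begin
      (a · + den n + w · u · x) · + (64 ℕ.^ suc n)
        ≡⟨ cong₂ (λ d g → (a · d + w · u · x) · g) pos-den (ℤ.pos-* 64 (64 ℕ.^ n)) ⟩
      (a · ((+ 2 · + n + 1ℤ) · x) + w · u · x) · (+ 64 · x)
        ≡⟨ ring₁ a (+ n) x (w · u) ⟩
      + 64 · ((+ 2 · + n + 1ℤ) · a + w · u) · (x · x)
        ≡⟨ cong (λ y → + 64 · ((+ 2 · + n + 1ℤ) · a + y) · (x · x))
             (cong₂ _·_ (pos-quadratic 92 61 9 n) (pos-binomials n)) ⟩
      + 64 · ((+ 2 · + n + 1ℤ) · a
        + weight (+ n) · (central n · multichoose (2 * n) n · central (2 * n))) · (x · x)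
        ≡⟨ cong (_· (x · x)) step ⟨
      (+ 2 · + n + 1ℤ) · b · (x · x)
        ≡⟨ ring₂ b (+ n) x ⟩
      b · (x · ((+ 2 · + n + 1ℤ) · x))
        ≡⟨ cong (λ d → b · (x · d)) pos-den ⟨
      b · (x · + den n) ∎)
  where
  open ≡-Reasoning
  w u x : ℤ
  w = + (92 * n * n ℕ.+ 61 * n ℕ.+ 9)
  u = + (((2 * n) C n) * ((3 * n) C n) * ((4 * n) C (2 * n)))
  x = + (64 ℕ.^ n)
  pos-den : + den n ≡ (+ 2 · + n + 1ℤ) · x
  pos-den = trans (ℤ.pos-* (suc (2 * n)) (64 ℕ.^ n))
    (cong (_· x) (trans (ℤ.+-comm 1ℤ (+ (2 * n))) (cong (λ y → y + 1ℤ) (ℤ.pos-* 2 n))))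
  ring₁ : ∀ a n x y → (a · ((+ 2 · n + 1ℤ) · x) + y · x) · (+ 64 · x)
    ≡ + 64 · ((+ 2 · n + 1ℤ) · a + y) · (x · x)
  ring₁ = solve-∀
  ring₂ : ∀ a n x → (+ 2 · n + 1ℤ) · a · (x · x) ≡ a · (x · ((+ 2 · n + 1ℤ) · x))
  ring₂ = solve-∀

sumTo-term : ∀ m → sumTo (suc m) term ≡ (partialNum m / 64 ℕ.^ suc m) {{m^n≢0 64 (suc m)}}
-- Both sides are 9 = 576/64 and compute once the abstract `bin` is unfolded.
sumTo-term zero rewrite bin-def 4 2 | bin-def 0 0 | bin-def 1 0 = refl
sumTo-term (suc m) = trans (cong (ℚ._+ term (suc m)) (sumTo-term m))
  (add-term (suc m) (partialNum m) (partialNum (suc m)) (partialNum-step m))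

-- The witnesses are the quotient `u` and the unreduced denominator `n`.
/-congModPow : ∀ p m a n c {{n≢0 : NonZero n}} → ¬ (p ℕ.∣ n) →
  (+ p) ^ m ∣ a - c · + n → CongModPow p m (a / n) (c / 1)
/-congModPow p m a n c {{n≢0}} p∤n (divides u eq) = u , n , n≢0 , p∤n ,
  /-sub a n c (+ (p ℕ.^ m)) u
    (trans eq (trans (ℤ.*-comm u ((+ p) ^ m)) (cong (_· u) (sym (pos-^ p m)))))

congModPow-64^ : ∀ p a → Prime p → ¬ (p ≡ 2) → (+ p) ^ 3 ∣ a - + 9 · + p · (+ 64) ^ p →
  CongModPow p 3 ((a / 64 ℕ.^ p) {{m^n≢0 64 p}}) ((+ (9 * p)) / 1)
congModPow-64^ p a pr p≢2 d =
  /-congModPow p 3 a (64 ℕ.^ p) (+ (9 * p)) {{m^n≢0 64 p}} (odd-prime∤64^ pr p≢2 p)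
    (∣-cong (cong₂ (λ x y → a - x · y) (sym (ℤ.pos-* 9 p)) (sym (pos-^ 64 p))) d)

theorem1p2 : (p : ℕ) → Prime p → ¬ (p ≡ 2) →
    CongModPow p 3 (sumTo p term) ((+ (9 * p)) / 1)
theorem1p2 zero    pr p≢2 = ⊥-elim (¬prime[0] pr)
theorem1p2 (suc r) pr p≢2 =
  subst (λ s → CongModPow (suc r) 3 s ((+ (9 * suc r)) / 1)) (sym (sumTo-term r))
    (congModPow-64^ (suc r) (partialNum r) pr p≢2 (partialNum-cong r pr p≢2))
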